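{- Let $L=\{E\}$ be the language of (finite, undirected, loopless) graphs, and consider the properties $\phi_{\rm none}(x)$: "$x$ is an isolated node", i.e. $(\forall y)\neg(xEy)$; $\phi_{\rm all}(x)$: "$x$ is adjacent to every other node", i.e. $(\forall y)(y\neq x\rightarrow xEy)$; $\phi_{\rm one}(x)$: "$x$ is adjacent to exactly one node", i.e. $(\exists! y)(xEy)$. Then $d(\phi_{\rm none}:\mathrm{typ})=d(\phi_{\rm all}:\mathrm{typ})=d(\phi_{\rm one}:\mathrm{typ})=0$.
   Context: $L$-structures are graphs $G=\langle A,E\rangle$ with $E$ a symmetric irreflexive binary relation on $A$; $\mathbf{S}_n(L)$ is the set of all such graphs with node set $\{1,\ldots,n\}$, so $|\mathbf{S}_n(L)|=2^{\binom{n}{2}}$. For a first-order formula $\phi(x)$ of $L$ with one free variable and a graph $G$ with node set $A$, $\phi(G)=\{a\in A:G\models\phi(a)\}$. Let $\mathbf{S}_n(\phi:\mathrm{typ})=\{G\in\mathbf{S}_n(L):|\phi(G)|>n/2\}$, $d_n(\phi:\mathrm{typ})=|\mathbf{S}_n(\phi:\mathrm{typ})|/|\mathbf{S}_n(L)|$, and $d(\phi:\mathrm{typ})=\lim_{n\to\infty}d_n(\phi:\mathrm{typ})$ whenever this limit exists. -}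

module Defs where

open import Data.Bool.Base using (Bool; true; false; T)
open import Data.Bool.Properties using (T?)
open import Data.Fin.Base using (Fin)
open import Data.Fin.Patterns using (0F; 1F; 2F)
open import Data.Fin.Properties using (_≟_; all?; any?)
open import Data.Integer.Base using (+_)
open import Data.List.Base using (List; []; _∷_; [_]; cartesianProductWith; filter; length; allFin)
open import Data.List.Membership.Propositional using (_∈_)
open import Data.List.Membership.Propositional.Properties
  using (∈-cartesianProductWith⁺; ∈-filter⁺; ∈-filter⁻)
open import Data.List.Relation.Unary.All using ([]; _∷_)
open import Data.List.Relation.Unary.AllPairs using ([]; _∷_)
open import Data.List.Relation.Unary.Any using (here; there)
open import Data.List.Relation.Unary.Unique.Propositional using (Unique)
open import Data.List.Relation.Unary.Unique.Propositional.Properties using (cartesianProductWith⁺; filter⁺)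
open import Data.Nat.Base using (ℕ; zero; suc; _≤_; NonZero)
open import Data.Product.Base using (∃-syntax; _×_; _,_; proj₂)
open import Data.Rational.Base as ℚ using (ℚ; 0ℚ; _/_; ∣_∣)
open import Data.Rational.Properties using (_<?_)
open import Data.Sum.Base using (_⊎_)
open import Data.Vec.Base using (Vec; []; _∷_; lookup; replicate)
open import Data.Vec.Properties using (∷-injective; lookup-replicate)
open import Function.Base using (case_of_)
open import Level using (0ℓ)
open import Relation.Binary.Core using (Rel)
open import Relation.Binary.Definitions using (Symmetric; Irreflexive; Decidable)
open import Relation.Binary.PropositionalEquality using (_≡_; refl; subst; cong; trans)
open import Relation.Nullary.Decidable using (Dec; map′; ¬?; _×-dec_; _⊎-dec_; _→-dec_)
open import Relation.Nullary.Negation using (¬_)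
open import Relation.Unary using (Pred)

------------------------------------------------------------------------
-- Graphs

-- A binary relation on an n-element set as a Boolean matrix, so that
-- extensionally equal relations are propositionally equal and
-- cardinalities can be computed by enumeration.  Fin n plays the role of
-- the node set {1,…,n}.
Structure : ℕ → Set
Structure n = Vec (Vec Bool n) n

Edge : ∀ {n} → Structure n → Rel (Fin n) 0ℓ
Edge G i j = T (lookup (lookup G i) j)

edge? : ∀ {n} (G : Structure n) → Decidable (Edge G)
edge? G i j = T? (lookup (lookup G i) j)

IsGraph : ∀ {n} → Structure n → Set
IsGraph G = Symmetric (Edge G) × Irreflexive _≡_ (Edge G)

isGraph? : ∀ {n} (G : Structure n) → Dec (IsGraph G)
isGraph? G =
        map′ (λ s {i} {j} → s i j) (λ s i j → s)
          (all? λ i → all? λ j → edge? G i j →-dec edge? G j i)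
  ×-dec map′ (λ { r {i} refl → r i }) (λ r i → r refl)
          (all? λ i → ¬? (edge? G i i))

vectors : ∀ {A : Set} → List A → ∀ n → List (Vec A n)
vectors xs zero    = [ [] ]
vectors xs (suc n) = cartesianProductWith _∷_ xs (vectors xs n)

-- 𝐒 n lists all graphs on n nodes; ∈-𝐒, 𝐒-sound and 𝐒-unique show that it
-- lists each of them exactly once, so that lengths are cardinalities.
𝐒 : ∀ n → List (Structure n)
𝐒 n = filter isGraph? (vectors (vectors (true ∷ false ∷ []) n) n)

vectors-complete : ∀ {A : Set} {xs : List A} → (∀ x → x ∈ xs) →
                   ∀ {n} (v : Vec A n) → v ∈ vectors xs n
vectors-complete p []      = here refl
vectors-complete p (x ∷ v) = ∈-cartesianProductWith⁺ _∷_ (p x) (vectors-complete p v)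

vectors-unique : ∀ {A : Set} {xs : List A} → Unique xs → ∀ n → Unique (vectors xs n)
vectors-unique u zero    = [] ∷ []
vectors-unique u (suc n) = cartesianProductWith⁺ _∷_ ∷-injective u (vectors-unique u n)

∈-𝐒 : ∀ {n} {G : Structure n} → IsGraph G → G ∈ 𝐒 n
∈-𝐒 {G = G} = ∈-filter⁺ isGraph? (vectors-complete (vectors-complete bool) G)
  where
  bool : ∀ b → b ∈ true ∷ false ∷ []
  bool true  = here refl
  bool false = there (here refl)

𝐒-sound : ∀ {n} {G : Structure n} → G ∈ 𝐒 n → IsGraph G
𝐒-sound {n} G∈ = proj₂ (∈-filter⁻ isGraph? {xs = vectors (vectors (true ∷ false ∷ []) n) n} G∈)

𝐒-unique : ∀ n → Unique (𝐒 n)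
𝐒-unique n = filter⁺ isGraph?
  (vectors-unique (vectors-unique (((λ ()) ∷ []) ∷ [] ∷ []) n) n)

𝐒-nonZero : ∀ n → NonZero (length (𝐒 n))
𝐒-nonZero n = nonEmpty (∈-𝐒 {G = empty} ((λ {i} {j} e → contra i j e) , λ {i} {j} _ e → contra i j e))
  where
  empty : Structure n
  empty = replicate n (replicate n false)

  contra : ∀ i j {A : Set} → Edge empty i j → A
  contra i j e = case subst T (trans (cong (λ r → lookup r j) (lookup-replicate i (replicate n false)))
                                     (lookup-replicate j false)) e of λ ()

  nonEmpty : ∀ {A : Set} {x : A} {xs} → x ∈ xs → NonZero (length xs)
  nonEmpty (here _)  = _
  nonEmpty (there _) = _

------------------------------------------------------------------------
-- First-order logic over L = {E}

-- Formulas with free variables in Fin k (de Bruijn indices: a quantifier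
-- binds variable zero of its body).
infix  8 _∼_ _≐_
infixr 7 _∧′_
infixr 6 _∨′_
infixr 5 _⇒′_

data Formula (k : ℕ) : Set where
  _∼_ _≐_        : Fin k → Fin k → Formula k
  ¬′_            : Formula k → Formula k
  _∧′_ _∨′_ _⇒′_ : Formula k → Formula k → Formula k
  ∀′ ∃′          : Formula (suc k) → Formula k

infix 4 _,_⊨_

_,_⊨_ : ∀ {n k} → Structure n → Vec (Fin n) k → Formula k → Set
G , ρ ⊨ x ∼ y  = Edge G (lookup ρ x) (lookup ρ y)
G , ρ ⊨ x ≐ y  = lookup ρ x ≡ lookup ρ y
G , ρ ⊨ ¬′ φ   = ¬ (G , ρ ⊨ φ)
G , ρ ⊨ φ ∧′ ψ = (G , ρ ⊨ φ) × (G , ρ ⊨ ψ)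
G , ρ ⊨ φ ∨′ ψ = (G , ρ ⊨ φ) ⊎ (G , ρ ⊨ ψ)
G , ρ ⊨ φ ⇒′ ψ = (G , ρ ⊨ φ) → (G , ρ ⊨ ψ)
G , ρ ⊨ ∀′ φ   = ∀ a → G , a ∷ ρ ⊨ φ
G , ρ ⊨ ∃′ φ   = ∃[ a ] (G , a ∷ ρ ⊨ φ)

sat? : ∀ {n k} (G : Structure n) (ρ : Vec (Fin n) k) (φ : Formula k) → Dec (G , ρ ⊨ φ)
sat? G ρ (x ∼ y)  = edge? G (lookup ρ x) (lookup ρ y)
sat? G ρ (x ≐ y)  = lookup ρ x ≟ lookup ρ y
sat? G ρ (¬′ φ)   = ¬? (sat? G ρ φ)
sat? G ρ (φ ∧′ ψ) = sat? G ρ φ ×-dec sat? G ρ ψ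
sat? G ρ (φ ∨′ ψ) = sat? G ρ φ ⊎-dec sat? G ρ ψ
sat? G ρ (φ ⇒′ ψ) = sat? G ρ φ →-dec sat? G ρ ψ
sat? G ρ (∀′ φ)   = all? λ a → sat? G (a ∷ ρ) φ
sat? G ρ (∃′ φ)   = any? λ a → sat? G (a ∷ ρ) φ

-- φ(G), as a repetition-free list.
extension : ∀ {n} → Formula 1 → Structure n → List (Fin n)
extension {n} φ G = filter (λ a → sat? G (a ∷ []) φ) (allFin n)

φ-none φ-all φ-one : Formula 1

-- x is 1F and y is 0F.
φ-none = ∀′ (¬′ (1F ∼ 0F))

-- x is 1F and y is 0F.
φ-all = ∀′ (¬′ (0F ≐ 1F) ⇒′ 1F ∼ 0F)

-- ∃!y (xEy) abbreviates ∃y (xEy ∧ ∀z (xEz → z = y)); under ∀z, x is 2F,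
-- y is 1F and z is 0F.
φ-one = ∃′ (1F ∼ 0F ∧′ ∀′ (2F ∼ 0F ⇒′ 0F ≐ 1F))

------------------------------------------------------------------------
-- Typical properties

Typical : ∀ {n} → Formula 1 → Pred (Structure n) 0ℓ
Typical {n} φ G = + n / 2 ℚ.< + length (extension φ G) / 1

typical? : ∀ {n} (φ : Formula 1) (G : Structure n) → Dec (Typical φ G)
typical? {n} φ G = + n / 2 <? + length (extension φ G) / 1

𝐒-typ : ∀ n → Formula 1 → List (Structure n)
𝐒-typ n φ = filter (typical? φ) (𝐒 n)

d-typ : Formula 1 → ℕ → ℚ
d-typ φ n = _/_ (+ length (𝐒-typ n φ)) (length (𝐒 n)) ⦃ 𝐒-nonZero n ⦄

-- It suffices to let ε range over the positive rationals, also for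
-- convergence in ℝ.
infix 4 _⟶_

_⟶_ : (ℕ → ℚ) → ℚ → Set
f ⟶ l = ∀ ε → 0ℚ ℚ.< ε → ∃[ N ] (∀ n → N ≤ n → ∣ f n ℚ.- l ∣ ℚ.< ε)

{-# OPTIONS --safe #-}

-- In each of the three cases the row of x in the adjacency matrix is nearly
-- constant: off the diagonal it equals a fixed β in all but at most one place.
-- Fix a vertex a.  If row a is nearly β, then it can be toggled at one of at
-- least n ∸ 2 places carrying β; conversely a given graph arises by such a
-- toggling in at most two ways, since its row a differs from β only at the
-- toggled place and at the exceptional one.  Hence at most a fraction 2 / (n ∸ 2) of all
-- graphs has a nearly constant row a, and by Markov's inequality at most a
-- fraction 4 / (n ∸ 2) has more than n / 2 such rows.

module Submission where

open import Defs
open import Data.Bool.Base using (Bool; true; false; T; not; _∧_; _∨_; _xor_)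
open import Data.Bool.Properties
  using (∧-comm; ∨-comm; not-¬; xor-assoc; xor-same; T-≡)
  renaming (_≟_ to _≟ᵇ_)
open import Data.Fin.Base using (Fin)
open import Data.Fin.Properties using (_≟_)
open import Data.Integer.Base as ℤ using (+[1+_]; -[1+_]; +<+)
open import Data.Integer.Properties using (drop‿+<+; pos-*)
open import Data.List.Base using (List; []; _∷_; _++_; filter; length; map; allFin)
open import Data.List.Membership.Propositional using (_∈_)
open import Data.List.Membership.Propositional.Properties
  using (∈-∃++; ∈-allFin; ∈-filter⁺; ∈-filter⁻; ∈-map⁻; ∈-++⁺ˡ; ∈-++⁺ʳ; ∈-++⁻)
open import Data.List.Properties using (length-map; length-++; length-tabulate)
open import Data.List.Relation.Binary.Subset.Propositional using (_⊆_)
open import Data.List.Relation.Binary.Subset.Propositional.Properties using (filter-⊆; filter⁺′)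
open import Data.List.Relation.Unary.All as All using ()
open import Data.List.Relation.Unary.Any using (here; there)
open import Data.List.Relation.Unary.AllPairs using ([]; _∷_)
open import Data.List.Relation.Unary.Unique.Propositional using (Unique)
open import Data.List.Relation.Unary.Unique.Propositional.Properties using (map⁺; filter⁺; allFin⁺)
open import Data.Nat.Base
open import Data.Nat.Coprimality using (Coprime)
open import Data.Nat.ListAction using (sum)
open import Data.Nat.Properties hiding (_≟_)
open import Data.Nat.Tactic.RingSolver using (solve-∀)
open import Data.Product.Base using (_×_; _,_; ∃-syntax; proj₁; proj₂)
open import Data.Rational.Base as ℚ using (0ℚ; mkℚ)
import Data.Rational.Properties as ℚ
open import Data.Rational.Unnormalised.Base using (mkℚᵘ; *<*)
import Data.Rational.Unnormalised.Properties as ℚᵘ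
open import Data.Sum.Base using (inj₁; inj₂)
open import Data.Vec.Base using ([]; _∷_; lookup; tabulate)
open import Data.Vec.Properties using (lookup∘tabulate; tabulate∘lookup; tabulate-cong)
open import Function.Base using (_∘_; flip)
open import Function.Bundles using (Equivalence)
open import Relation.Binary.Definitions using (Decidable)
open import Relation.Binary.PropositionalEquality
open import Relation.Nullary.Decidable using (yes; no; does; ¬?; _×-dec_; dec-true; dec-false)
open import Relation.Nullary.Negation using (¬_; contradiction)
import Relation.Unary as U

private variable
  A B : Set
  n : ℕ

-- Counting in lists

∑ : List A → (A → ℕ) → ℕ
∑ xs f = sum (map f xs)

∑-mono : (xs : List A) {f g : A → ℕ} → (∀ x → f x ≤ g x) → ∑ xs f ≤ ∑ xs g
∑-mono []       f≤g = z≤n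
∑-mono (x ∷ xs) f≤g = +-mono-≤ (f≤g x) (∑-mono xs f≤g)

-- The factor `c` stands in for a denominator: a lower bound `p / c` on each term is stated without
-- division. This is how "more than half of the vertices" enters Markov's inequality.
∑-lower : ∀ (xs : List A) {f : A → ℕ} {p} c → (∀ {x} → x ∈ xs → p ≤ c * f x) →
          p * length xs ≤ c * ∑ xs f
∑-lower []       {f} {p} c h = ≤-trans (≤-reflexive (*-zeroʳ p)) z≤n
∑-lower (x ∷ xs) {f} {p} c h = begin
  p * suc (length xs)      ≡⟨ *-suc p (length xs) ⟩
  p + p * length xs        ≤⟨ +-mono-≤ (h (here refl)) (∑-lower xs c (h ∘ there)) ⟩
  c * f x + c * ∑ xs f     ≡⟨ *-distribˡ-+ c (f x) (∑ xs f) ⟨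
  c * (f x + ∑ xs f)       ∎
  where open ≤-Reasoning

∑-upper : ∀ (xs : List A) {f : A → ℕ} {p} c → (∀ {x} → x ∈ xs → c * f x ≤ p) →
          c * ∑ xs f ≤ p * length xs
∑-upper []       {f} {p} c h = ≤-trans (≤-reflexive (*-zeroʳ c)) z≤n
∑-upper (x ∷ xs) {f} {p} c h = begin
  c * (f x + ∑ xs f)       ≡⟨ *-distribˡ-+ c (f x) (∑ xs f) ⟩
  c * f x + c * ∑ xs f     ≤⟨ +-mono-≤ (h (here refl)) (∑-upper xs c (h ∘ there)) ⟩
  p + p * length xs        ≡⟨ *-suc p (length xs) ⟨
  p * suc (length xs)      ∎
  where open ≤-Reasoning

count : {P : A → Set} → U.Decidable P → List A → ℕ
count P? xs = length (filter P? xs)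

+-exchange : ∀ a b c → a + (b + c) ≡ b + (a + c)
+-exchange = solve-∀

module _ {R : A → B → Set} (R? : Decidable R) where

  ∑-count-∷ : ∀ x xs ys → ∑ ys (λ y → count (λ x → R? x y) (x ∷ xs)) ≡
                          count (R? x) ys + ∑ ys (λ y → count (λ x → R? x y) xs)
  ∑-count-∷ x xs []       = refl
  ∑-count-∷ x xs (y ∷ ys) with ih ← ∑-count-∷ x xs ys | does (R? x y)
  ... | true  = cong suc (trans (cong (k +_) ih) (+-exchange k l m))
    where
    k = count (λ x → R? x y) xs
    l = count (R? x) ys
    m = ∑ ys λ y → count (λ x → R? x y) xs
  ... | false = trans (cong (k +_) ih) (+-exchange k l m)
    where
    k = count (λ x → R? x y) xs
    l = count (R? x) ys
    m = ∑ ys λ y → count (λ x → R? x y) xs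

  -- Double counting: both sides count the related pairs, once by rows and once by columns.
  ∑-count-swap : ∀ xs ys → ∑ xs (λ x → count (R? x) ys) ≡ ∑ ys (λ y → count (λ x → R? x y) xs)
  ∑-count-swap []       ys = sym (zeros ys)
    where
    zeros : ∀ (ys : List B) → ∑ ys (λ _ → 0) ≡ 0
    zeros []       = refl
    zeros (_ ∷ ys) = zeros ys
  ∑-count-swap (x ∷ xs) ys = trans (cong (count (R? x) ys +_) (∑-count-swap xs ys))
                                   (sym (∑-count-∷ x xs ys))

-- Delete one occurrence of the head `x` from `ys`. The tail of `xs` stays inside what remains,
-- since `x` does not recur in it.
unique-⊆-length : {xs ys : List A} → Unique xs → xs ⊆ ys → length xs ≤ length ys
unique-⊆-length []                   _     = z≤n
unique-⊆-length {xs = x ∷ xs} (x∉ ∷ u) xs⊆ with as , bs , refl ← ∈-∃++ (xs⊆ (here refl)) = begin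
  suc (length xs)               ≤⟨ s≤s (unique-⊆-length u delete) ⟩
  suc (length (as ++ bs))       ≡⟨ cong suc (length-++ as) ⟩
  suc (length as + length bs)   ≡⟨ +-suc (length as) (length bs) ⟨
  length as + suc (length bs)   ≡⟨ length-++ as ⟨
  length (as ++ x ∷ bs)         ∎
  where
  open ≤-Reasoning
  delete : xs ⊆ as ++ bs
  delete z∈xs with ∈-++⁻ as (xs⊆ (there z∈xs))
  ... | inj₁ z∈as         = ∈-++⁺ˡ z∈as
  ... | inj₂ (here z≡x)   = contradiction (sym z≡x) (All.lookup x∉ z∈xs)
  ... | inj₂ (there z∈bs) = ∈-++⁺ʳ as z∈bs

-- The second element may depend on the first, so it can be extracted from any given member, and the
-- empty list needs none.
unique-pair-length : {xs : List A} → Unique xs →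
                     (∀ {x} → x ∈ xs → ∃[ y ] (xs ⊆ x ∷ y ∷ [])) → length xs ≤ 2
unique-pair-length {xs = []}    u h = z≤n
unique-pair-length {xs = _ ∷ _} u h = unique-⊆-length u (proj₂ (h (here refl)))

-- Toggling an edge

entry : Structure n → Fin n → Fin n → Bool
entry G i j = lookup (lookup G i) j

entry-ext : {G H : Structure n} → (∀ i j → entry G i j ≡ entry H i j) → G ≡ H
entry-ext {G = G} {H} eq =
  trans (sym (tabulate∘lookup G)) (trans (tabulate-cong rows) (tabulate∘lookup H))
  where
  rows : ∀ i → lookup G i ≡ lookup H i
  rows i = trans (sym (tabulate∘lookup _)) (trans (tabulate-cong (eq i)) (tabulate∘lookup _))

isPair : Fin n → Fin n → Fin n → Fin n → Bool
isPair a b i j = (does (i ≟ a) ∧ does (j ≟ b)) ∨ (does (i ≟ b) ∧ does (j ≟ a))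

isPair-sym : (a b i j : Fin n) → isPair a b i j ≡ isPair a b j i
isPair-sym a b i j = trans (∨-comm (does (i ≟ a) ∧ does (j ≟ b)) _)
  (cong₂ _∨_ (∧-comm (does (i ≟ b)) _) (∧-comm (does (i ≟ a)) _))

isPair-true : (a b : Fin n) → isPair a b a b ≡ true
isPair-true a b rewrite dec-true (a ≟ a) refl | dec-true (b ≟ b) refl = refl

isPair-false : (a b : Fin n) {c : Fin n} → ¬ c ≡ a → ¬ c ≡ b → isPair a b a c ≡ false
isPair-false a b {c} c≢a c≢b
  rewrite dec-false (c ≟ a) c≢a | dec-false (c ≟ b) c≢b
        | ∧-comm (does (a ≟ a)) false = ∧-comm (does (a ≟ b)) false

isPair-irrefl : {a b : Fin n} → ¬ b ≡ a → ∀ i → isPair a b i i ≡ false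
isPair-irrefl {a = a} {b} b≢a i with i ≟ a | i ≟ b
... | yes refl | yes refl = contradiction refl b≢a
... | yes refl | no _     = refl
... | no _     | yes _    = refl
... | no _     | no _     = refl

toggle : Fin n → Fin n → Structure n → Structure n
toggle a b G = tabulate λ i → tabulate λ j → isPair a b i j xor entry G i j

entry-toggle : ∀ (a b : Fin n) G i j → entry (toggle a b G) i j ≡ isPair a b i j xor entry G i j
entry-toggle a b G i j =
  trans (cong (flip lookup j) (lookup∘tabulate _ i)) (lookup∘tabulate _ j)

toggle-involutive : ∀ (a b : Fin n) G → toggle a b (toggle a b G) ≡ G
toggle-involutive a b G = entry-ext {G = toggle a b (toggle a b G)} {G} λ i j →
  let e = isPair a b i j in begin
  entry (toggle a b (toggle a b G)) i j  ≡⟨ entry-toggle a b (toggle a b G) i j ⟩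
  e xor entry (toggle a b G) i j         ≡⟨ cong (e xor_) (entry-toggle a b G i j) ⟩
  e xor (e xor entry G i j)              ≡⟨ xor-assoc e e _ ⟨
  (e xor e) xor entry G i j              ≡⟨ cong (_xor entry G i j) (xor-same e) ⟩
  entry G i j                            ∎
  where open ≡-Reasoning

toggle-injective : ∀ (a b : Fin n) {G H} → toggle a b G ≡ toggle a b H → G ≡ H
toggle-injective a b eq =
  trans (sym (toggle-involutive a b _)) (trans (cong (toggle a b) eq) (toggle-involutive a b _))

entry-toggle-at : ∀ (a b : Fin n) G → entry (toggle a b G) a b ≡ not (entry G a b)
entry-toggle-at a b G = trans (entry-toggle a b G a b) (cong (_xor entry G a b) (isPair-true a b))

entry-toggle-off : ∀ (a b : Fin n) G {c} → ¬ c ≡ a → ¬ c ≡ b → entry (toggle a b G) a c ≡ entry G a c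
entry-toggle-off a b G {c} c≢a c≢b =
  trans (entry-toggle a b G a c) (cong (_xor entry G a c) (isPair-false a b c≢a c≢b))

toggle-isGraph : ∀ {a b : Fin n} G → ¬ b ≡ a → IsGraph G → IsGraph (toggle a b G)
toggle-isGraph {a = a} {b} G b≢a (G-sym , G-irr) = symm , λ { {i} refl → irr i }
  where
  -- Negation reverses implications, so both directions between `x` and `y` are required.
  T-xor : ∀ e {x y} → (T x → T y) → (T y → T x) → T (e xor x) → T (e xor y)
  T-xor false                f g   = f
  T-xor true {_}     {false} f g _ = _
  T-xor true {false} {true}  f g _ = g _

  symm : ∀ {i j} → Edge (toggle a b G) i j → Edge (toggle a b G) j i
  symm {i} {j} ij = subst T (sym (entry-toggle a b G j i))
    (subst (λ e → T (e xor entry G j i)) (isPair-sym a b i j)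
      (T-xor (isPair a b i j) (G-sym {i} {j}) (G-sym {j} {i})
        (subst T (entry-toggle a b G i j) ij)))

  irr : ∀ i → ¬ Edge (toggle a b G) i i
  irr i ii = G-irr {i} refl (subst (λ e → T (e xor entry G i i)) (isPair-irrefl b≢a i)
    (subst T (entry-toggle a b G i i) ii))

-- Nearly constant rows

-- The diagonal place is exempt anyway, so `c` equal to `a` means that there is no exception.
NearlyConst : Bool → Structure n → Fin n → Set
NearlyConst β G a = ∃[ c ] (∀ b → ¬ b ≡ a → ¬ b ≡ c → entry G a b ≡ β)

module _ (β : Bool) (a : Fin n) {P : Structure n → Set} (P? : U.Decidable P)
         (nearly : ∀ G → P G → NearlyConst β G a) where

  -- A place of row `a` that may be toggled; `vertex-bound` counts pairs of a graph and such a place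
  -- in two ways.
  Slot : Structure n → Fin n → Set
  Slot G b = P G × ¬ b ≡ a × entry G a b ≡ β

  slot? : Decidable Slot
  slot? G b = P? G ×-dec ¬? (b ≟ a) ×-dec (entry G a b ≟ᵇ β)

  slots-≥ : ∀ G → P G → n ∸ 2 ≤ count (slot? G) (allFin n)
  slots-≥ G p with c , eq ← nearly G p = m≤n+o⇒m∸n≤o n 2 (begin
    n                                     ≡⟨ length-tabulate _ ⟨
    length (allFin n)                     ≤⟨ unique-⊆-length (allFin⁺ n) cover ⟩
    2 + count (slot? G) (allFin n)        ∎)
    where
    open ≤-Reasoning
    cover : allFin n ⊆ a ∷ c ∷ filter (slot? G) (allFin n)
    cover {b} _ with b ≟ a | b ≟ c
    ... | yes b≡a | _       = here b≡a
    ... | no  _   | yes b≡c = there (here b≡c)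
    ... | no  b≢a | no  b≢c = there (there
      (∈-filter⁺ (slot? G) (∈-allFin b) (p , b≢a , eq b b≢a b≢c)))

  -- Toggling is an involution, so the ways in which `H` arises by toggling a slot correspond to the
  -- `b` for which `toggle a b H` has slot `b`. Given one such `b₀`, any other is the exceptional
  -- place of row `a` in `toggle a b₀ H`.
  preimages-≤ : ∀ H → count (λ b → slot? (toggle a b H) b) (allFin n) ≤ 2
  preimages-≤ H = unique-pair-length (filter⁺ Q? (allFin⁺ n)) pair
    where
    Q? = λ b → slot? (toggle a b H) b
    slot : ∀ {b} → b ∈ filter Q? (allFin n) → Slot (toggle a b H) b
    slot = proj₂ ∘ ∈-filter⁻ Q? {xs = allFin n}
    pair : ∀ {b₀} → b₀ ∈ filter Q? (allFin n) → ∃[ c₀ ] (filter Q? (allFin n) ⊆ b₀ ∷ c₀ ∷ [])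
    pair {b₀} b₀∈ with c₀ , eq ← nearly _ (proj₁ (slot b₀∈)) = c₀ , sub
      where
      sub : filter Q? (allFin n) ⊆ b₀ ∷ c₀ ∷ []
      sub {b} b∈ with b ≟ b₀ | b ≟ c₀
      ... | yes b≡b₀ | _        = here b≡b₀
      ... | no  _    | yes b≡c₀ = there (here b≡c₀)
      -- Toggling at `b` produces `β`, so `H` carries the opposite value there; but `toggle a b₀ H`
      -- agrees with `H` at `b` and carries `β` there.
      ... | no  b≢b₀ | no  b≢c₀ with _ , b≢a , toggled ← slot b∈ =
        contradiction (trans (sym toggled) (entry-toggle-at a b H))
          (not-¬ (trans (sym (eq b b≢a b≢c₀)) (entry-toggle-off a b₀ H b≢a b≢b₀)))

  vertex-bound : (n ∸ 2) * count P? (𝐒 n) ≤ 2 * length (𝐒 n)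
  vertex-bound = begin
    (n ∸ 2) * length X
      ≤⟨ ∑-lower X 1 (λ G∈X → ≤-trans (slots-≥ _ (proj₂ (∈-filter⁻ P? {xs = 𝐒 n} G∈X)))
                                      (≤-reflexive (sym (*-identityˡ _)))) ⟩
    1 * ∑ X (λ G → count (slot? G) (allFin n))
      ≡⟨ cong (1 *_) (∑-count-swap slot? X (allFin n)) ⟩
    1 * ∑ (allFin n) (λ b → count (λ G → slot? G b) X)
      -- For fixed `b`, toggling maps the graphs with slot `b` injectively to the graphs `H` whose
      -- toggle has slot `b`.
      ≤⟨ *-monoʳ-≤ 1 (∑-mono (allFin n) inject) ⟩
    1 * ∑ (allFin n) (λ b → count (λ H → slot? (toggle a b H) b) (𝐒 n))
      ≡⟨ cong (1 *_) (∑-count-swap (λ H b → slot? (toggle a b H) b) (𝐒 n) (allFin n)) ⟨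
    1 * ∑ (𝐒 n) (λ H → count (λ b → slot? (toggle a b H) b) (allFin n))
      ≤⟨ ∑-upper (𝐒 n) 1 (λ {H} _ → ≤-trans (≤-reflexive (*-identityˡ _)) (preimages-≤ H)) ⟩
    2 * length (𝐒 n) ∎
    where
    open ≤-Reasoning
    X = filter P? (𝐒 n)
    inject : ∀ b → count (λ G → slot? G b) X ≤ count (λ H → slot? (toggle a b H) b) (𝐒 n)
    inject b = subst (_≤ count (λ H → slot? (toggle a b H) b) (𝐒 n))
      (length-map (toggle a b) (filter (λ G → slot? G b) X))
      (unique-⊆-length
        (map⁺ (toggle-injective a b) (filter⁺ (λ G → slot? G b) (filter⁺ P? (𝐒-unique n)))) sub)
      where
      sub : map (toggle a b) (filter (λ G → slot? G b) X) ⊆ filter (λ H → slot? (toggle a b H) b) (𝐒 n)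
      sub H∈ with G , G∈ , refl ← ∈-map⁻ (toggle a b) H∈
             with G∈X , s@(_ , b≢a , _) ← ∈-filter⁻ (λ G → slot? G b) {xs = X} G∈ =
        ∈-filter⁺ (λ H → slot? (toggle a b H) b)
          (∈-𝐒 (toggle-isGraph G b≢a (𝐒-sound (filter-⊆ P? (𝐒 n) G∈X))))
          (subst (flip Slot b) (sym (toggle-involutive a b G)) s)

-- Passing to the limit

-- `ℚ./` reduces to lowest terms, so the comparison passes through unnormalised rationals, where it
-- is cross-multiplication.
/-<⁻ : ∀ {m n c d} .⦃ _ : NonZero c ⦄ .⦃ _ : NonZero d ⦄ →
       ℤ.+ m ℚ./ c ℚ.< ℤ.+ n ℚ./ d → m * d < n * c
/-<⁻ {m} {n} {c@(suc _)} {d@(suc _)} lt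
  with *<* lt′ ← ℚᵘ.<-respˡ-≃ (ℚ.toℚᵘ-fromℚᵘ (mkℚᵘ (ℤ.+ m) (pred c)))
                   (ℚᵘ.<-respʳ-≃ (ℚ.toℚᵘ-fromℚᵘ (mkℚᵘ (ℤ.+ n) (pred d))) (ℚ.toℚᵘ-mono-< lt))
  = drop‿+<+ (subst₂ ℤ._<_ (sym (pos-* m d)) (sym (pos-* n c)) lt′)

/-<⁺ : ∀ {m c p q} .⦃ _ : NonZero c ⦄ .{cop : Coprime p (suc q)} → m * suc q < p * c →
       ℤ.+ m ℚ./ c ℚ.< mkℚ (ℤ.+ p) q cop
/-<⁺ {m} {c@(suc _)} {p} {q} lt =
  ℚ.toℚᵘ-cancel-< (ℚᵘ.<-respˡ-≃ (ℚᵘ.≃-sym (ℚ.toℚᵘ-fromℚᵘ (mkℚᵘ (ℤ.+ m) (pred c))))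
    (*<* (subst₂ ℤ._<_ (pos-* m (suc q)) (pos-* p c) (+<+ lt))))

module _ (β : Bool) (φ : Formula 1)
         (nearly : ∀ {n} (G : Structure n) {a} → G , a ∷ [] ⊨ φ → NearlyConst β G a) where

  sat-at? : (a : Fin n) → U.Decidable (λ G → G , a ∷ [] ⊨ φ)
  sat-at? a G = sat? G (a ∷ []) φ

  typical-half : {G : Structure n} → Typical φ G → n ≤ 2 * length (extension φ G)
  typical-half {n} {G} t = <⇒≤ (subst₂ _<_ (*-identityʳ n) (*-comm k 2) (/-<⁻ {m = n} {n = k} t))
    where k = length (extension φ G)

  -- Markov's inequality: count the pairs of a typical graph and a vertex satisfying `φ`. Each graph
  -- contributes at least `n / 2` of them and each vertex is limited by `vertex-bound`; then `n`
  -- cancels.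
  typical-bound : ∀ n .⦃ _ : NonZero n ⦄ → (n ∸ 2) * length (𝐒-typ n φ) ≤ 4 * length (𝐒 n)
  typical-bound n = *-cancelˡ-≤ n (begin
    n * ((n ∸ 2) * x)                 ≡⟨ exchange n (n ∸ 2) x ⟩
    (n ∸ 2) * (n * x)
      ≤⟨ *-monoʳ-≤ (n ∸ 2) (∑-lower X 2 (λ {G} G∈X →
           typical-half {G = G} (proj₂ (∈-filter⁻ (typical? φ) {xs = 𝐒 n} G∈X)))) ⟩
    (n ∸ 2) * (2 * ∑ X (λ G → length (extension φ G)))
      ≡⟨ cong (λ k → (n ∸ 2) * (2 * k)) (∑-count-swap (flip sat-at?) X (allFin n)) ⟩
    (n ∸ 2) * (2 * ∑ (allFin n) (λ a → count (sat-at? a) X))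
      ≡⟨ exchange (n ∸ 2) 2 _ ⟩
    2 * ((n ∸ 2) * ∑ (allFin n) (λ a → count (sat-at? a) X))
      ≤⟨ *-monoʳ-≤ 2 (∑-upper (allFin n) (n ∸ 2) (λ {a} _ → at a)) ⟩
    2 * (2 * s * length (allFin n))   ≡⟨ cong (λ k → 2 * (2 * s * k)) (length-tabulate {n = n} _) ⟩
    2 * (2 * s * n)                   ≡⟨ regroup s n ⟩
    n * (4 * s)                       ∎)
    where
    open ≤-Reasoning
    X = 𝐒-typ n φ
    x = length X
    s = length (𝐒 n)
    exchange : ∀ a b c → a * (b * c) ≡ b * (a * c)
    exchange = solve-∀
    regroup : ∀ s n → 2 * (2 * s * n) ≡ n * (4 * s)
    regroup = solve-∀
    at : ∀ a → (n ∸ 2) * count (sat-at? a) X ≤ 2 * s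
    at a = ≤-trans
      -- The typical graphs satisfying `φ` at `a` are among all graphs satisfying it there.
      (*-monoʳ-≤ (n ∸ 2) (unique-⊆-length (filter⁺ _ (filter⁺ (typical? φ) (𝐒-unique n)))
        (filter⁺′ (sat-at? a) (sat-at? a) (λ p → p) (filter-⊆ (typical? φ) (𝐒 n)))))
      (vertex-bound β a (sat-at? a) (λ G → nearly G))

  d-typ⟶0 : d-typ φ ⟶ 0ℚ
  -- Here ε is `suc p / suc q`, which is at least `1 / suc q`. The threshold makes `n ∸ 2` at least
  -- `1 + 4 * suc q`, hence `4 / (n ∸ 2)` smaller than `1 / suc q`.
  d-typ⟶0 (mkℚ +[1+ p ] q _) _ = 3 + 4 * suc q , close
    where
    close : ∀ n → 3 + 4 * suc q ≤ n → ℚ.∣ d-typ φ n ℚ.- 0ℚ ∣ ℚ.< _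
    close n@(suc _) N≤n = subst (ℚ._< _) (sym abs) (/-<⁺ {m = x} {c = s} {p = suc p} bound)
      where
      x = length (𝐒-typ n φ)
      s = length (𝐒 n)
      instance
        s≢0 : NonZero s
        s≢0 = 𝐒-nonZero n
      abs : ℚ.∣ d-typ φ n ℚ.- 0ℚ ∣ ≡ d-typ φ n
      abs = trans (cong ℚ.∣_∣ (ℚ.+-identityʳ (d-typ φ n)))
                  (ℚ.0≤p⇒∣p∣≡p (ℚ.nonNegative⁻¹ _ ⦃ ℚ.normalize-nonNeg x s ⦄))
      scaled : (1 + 4 * suc q) * x ≤ 4 * s
      scaled = ≤-trans (*-monoˡ-≤ x (∸-monoˡ-≤ 2 N≤n)) (typical-bound n)
      small : ∀ x → (1 + 4 * suc q) * x ≤ 4 * s → x * suc q < s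
      -- The surplus `x` on the left of the hypothesis gives strictness when it is positive; for
      -- zero, strictness comes from the existence of a graph.
      small zero      _ = >-nonZero⁻¹ s
      small x@(suc _) h = *-cancelˡ-< 4 _ _ (begin-strict
        4 * (x * suc q)       <⟨ m<n+m _ z<s ⟩
        x + 4 * (x * suc q)   ≡⟨ factor x (suc q) ⟩
        (1 + 4 * suc q) * x   ≤⟨ h ⟩
        4 * s                 ∎)
        where
        open ≤-Reasoning
        factor : ∀ x r → x + 4 * (x * r) ≡ (1 + 4 * r) * x
        factor = solve-∀
      bound : x * suc q < suc p * s
      bound = <-≤-trans (small x scaled) (m≤n*m s (suc p))
  d-typ⟶0 (mkℚ (ℤ.+ 0) _ _) (ℚ.*<* (+<+ ()))
  d-typ⟶0 (mkℚ -[1+ _ ] _ _) (ℚ.*<* ())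

-- The three properties force nearly constant rows

¬T⇒≡false : ∀ {x} → ¬ T x → x ≡ false
¬T⇒≡false {true}  ¬t = contradiction _ ¬t
¬T⇒≡false {false} _  = refl

none-nearly : (G : Structure n) {a : Fin n} → G , a ∷ [] ⊨ φ-none → NearlyConst false G a
-- Row `a` has no exception off the diagonal, so `a` itself serves as the exceptional place.
none-nearly G {a} isolated = a , λ b _ _ → ¬T⇒≡false (isolated b)

all-nearly : (G : Structure n) {a : Fin n} → G , a ∷ [] ⊨ φ-all → NearlyConst true G a
all-nearly G {a} adjacent = a , λ b b≢a _ → Equivalence.to T-≡ (adjacent b b≢a)

one-nearly : (G : Structure n) {a : Fin n} → G , a ∷ [] ⊨ φ-one → NearlyConst false G a
-- The exceptional place is the unique neighbour.
one-nearly G (c , _ , only) = c , λ b _ b≢c → ¬T⇒≡false (b≢c ∘ only b)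

proposition6p1 : (d-typ φ-none ⟶ 0ℚ) × (d-typ φ-all ⟶ 0ℚ) × (d-typ φ-one ⟶ 0ℚ)
proposition6p1 = d-typ⟶0 false φ-none none-nearly
               , d-typ⟶0 true  φ-all  all-nearly
               , d-typ⟶0 false φ-one  one-nearly
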